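{- Let $\mathcal{N}$ be a matching class in a category $\mathbf{X}$ with pullbacks. Let $m:M\to X$ be an $\mathcal{N}$-adhesive monomorphism and let $n:N\to X$ be a monomorphism in $\mathcal{N}$. Let $p_1:P\to M$, $p_2:P\to N$ form a pullback of $m$ and $n$ (so $m\circ p_1=n\circ p_2$), let $u_1:N\to U$, $u_2:M\to U$ form a pushout of $p_2$ and $p_1$ (so $u_1\circ p_2=u_2\circ p_1$), and let $u:U\to X$ be the unique arrow with $u\circ u_1=n$ and $u\circ u_2=m$. Then $u$ is a monomorphism and, in the poset $(\mathsf{Sub}(X),\le)$, $[u]=[m]\vee[n]$.
   Context: A class $\mathcal{A}$ of arrows is stable under pullbacks (resp. pushouts) if for every pullback (resp. pushout) square with $f:A\to B$, $m:A\to C$, $n:B\to D$, $g:C\to D$, $n\circ f=g\circ m$, $n\in\mathcal{A}$ implies $m\in\mathcal{A}$ (resp. $m\in\mathcal{A}$ implies $n\in\mathcal{A}$). A matching class $\mathcal{N}$ is a class of arrows of $\mathbf{X}$ that contains all isomorphisms, is closed under composition, is closed under decomposition ($g\circ f\in\mathcal{N}$ and $g\in\mathcal{N}$ imply $f\in\mathcal{N}$), and is stable under pullbacks and pushouts. A pushout square $g:A\to B$, $m:A\to C$, $n:B\to D$, $f:C\to D$ is stable if for every commutative cube having it as bottom face, with vertical arrows $a:A'\to A$, $b:B'\to B$, $c:C'\to C$, $d:D'\to D$, if all four vertical faces are pullbacks then the top face is a pushout. An arrow $m:X\to Y$ is $\mathcal{N}$-preadhesive if for every $n:X\to Z$ in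 $\mathcal{N}$ a stable pushout square of $m$ along $n$ exists and it is also a pullback square. It is $\mathcal{N}$-adhesive if all its pullbacks are $\mathcal{N}$-preadhesive. (Hence, in the claim, the pushout of $p_2$ and $p_1$ exists, since $p_2$ is a pullback of $m$ and $p_1\in\mathcal{N}$ is a pullback of $n$.) $(\mathsf{Sub}(X),\le)$ is the poset of subobjects of $X$: isomorphism classes $[m]$ of monos into $X$, with $[m]\le[n]$ iff $m$ factors through $n$. -}

module Defs where

open import Level using (Level; suc; _⊔_)
open import Data.Product using (∃!; _×_; _,_; Σ-syntax; ∃-syntax)
open import Relation.Binary.Core using (Rel)
open import Relation.Binary.Bundles using (Poset)
open import Relation.Binary.Structures using (IsEquivalence)

-- Equality of parallel arrows is an equivalence relation _≈_ on each hom,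
-- so no quotient types or function extensionality are needed to have examples.
record Category (o ℓ e : Level) : Set (suc (o ⊔ ℓ ⊔ e)) where
  infix  4 _≈_
  infixr 9 _∘_
  field
    Obj     : Set o
    Hom     : Obj → Obj → Set ℓ
    _≈_     : ∀ {A B} → Rel (Hom A B) e
    id      : ∀ {A} → Hom A A
    _∘_     : ∀ {A B C} → Hom B C → Hom A B → Hom A C
    ≈-equiv : ∀ {A B} → IsEquivalence (_≈_ {A} {B})
    ∘-resp  : ∀ {A B C} {g g′ : Hom B C} {f f′ : Hom A B} →
              g ≈ g′ → f ≈ f′ → g ∘ f ≈ g′ ∘ f′
    assoc   : ∀ {A B C D} (h : Hom C D) (g : Hom B C) (f : Hom A B) →
              (h ∘ g) ∘ f ≈ h ∘ (g ∘ f)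
    idˡ     : ∀ {A B} (f : Hom A B) → id ∘ f ≈ f
    idʳ     : ∀ {A B} (f : Hom A B) → f ∘ id ≈ f

  module ≈ {A B} = IsEquivalence (≈-equiv {A} {B})

module _ {o ℓ e : Level} (𝐗 : Category o ℓ e) where
  open Category 𝐗

  Mono : ∀ {A B} → Hom A B → Set (o ⊔ ℓ ⊔ e)
  Mono {A} f = ∀ {Z} (g h : Hom Z A) → f ∘ g ≈ f ∘ h → g ≈ h

  record IsIso {A B} (f : Hom A B) : Set (ℓ ⊔ e) where
    field
      inv  : Hom B A
      invˡ : inv ∘ f ≈ id
      invʳ : f ∘ inv ≈ id

  -- Squares are always listed in the order f, m, n, g for
  --
  --        f
  --     A ───→ B
  --   m │      │ n
  --     ↓      ↓
  --     C ───→ D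
  --        g

  record IsPullback {A B C D} (f : Hom A B) (m : Hom A C)
                    (n : Hom B D) (g : Hom C D) : Set (o ⊔ ℓ ⊔ e) where
    field
      commutes  : n ∘ f ≈ g ∘ m
      universal : ∀ {Q} (h : Hom Q B) (k : Hom Q C) → n ∘ h ≈ g ∘ k →
                  ∃! _≈_ λ (t : Hom Q A) → f ∘ t ≈ h × m ∘ t ≈ k

  record IsPushout {A B C D} (f : Hom A B) (m : Hom A C)
                   (n : Hom B D) (g : Hom C D) : Set (o ⊔ ℓ ⊔ e) where
    field
      commutes  : n ∘ f ≈ g ∘ m
      universal : ∀ {Q} (h : Hom B Q) (k : Hom C Q) → h ∘ f ≈ k ∘ m →
                  ∃! _≈_ λ (t : Hom D Q) → t ∘ n ≈ h × t ∘ g ≈ k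

  HasPullbacks : Set (o ⊔ ℓ ⊔ e)
  HasPullbacks = ∀ {B C D} (n : Hom B D) (g : Hom C D) →
    ∃[ A ] Σ[ f ∈ Hom A B ] Σ[ m ∈ Hom A C ] IsPullback f m n g

  ArrowClass : (p : Level) → Set (o ⊔ ℓ ⊔ suc p)
  ArrowClass p = ∀ {A B} → Hom A B → Set p

  StableUnderPullbacks : ∀ {p} → ArrowClass p → Set (o ⊔ ℓ ⊔ e ⊔ p)
  StableUnderPullbacks 𝓐 =
    ∀ {A B C D} {f : Hom A B} {m : Hom A C} {n : Hom B D} {g : Hom C D} →
    IsPullback f m n g → 𝓐 n → 𝓐 m

  StableUnderPushouts : ∀ {p} → ArrowClass p → Set (o ⊔ ℓ ⊔ e ⊔ p)
  StableUnderPushouts 𝓐 =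
    ∀ {A B C D} {f : Hom A B} {m : Hom A C} {n : Hom B D} {g : Hom C D} →
    IsPushout f m n g → 𝓐 m → 𝓐 n

  -- Invariance of 𝓝 under ≈ is not a separate field: it follows from
  -- pullback stability, since f ≈ f′ makes (id, f, f′, id) a pullback square.
  record IsMatchingClass {p} (𝓝 : ArrowClass p) : Set (o ⊔ ℓ ⊔ e ⊔ p) where
    field
      isos            : ∀ {A B} {f : Hom A B} → IsIso f → 𝓝 f
      composition     : ∀ {A B C} {g : Hom B C} {f : Hom A B} →
                        𝓝 g → 𝓝 f → 𝓝 (g ∘ f)
      decomposition   : ∀ {A B C} {g : Hom B C} {f : Hom A B} →
                        𝓝 (g ∘ f) → 𝓝 g → 𝓝 f
      pullback-stable : StableUnderPullbacks 𝓝
      pushout-stable  : StableUnderPushouts 𝓝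

  -- The primed arrows form the top face of the cube, a, b, c, d the vertical
  -- edges; commutativity of the vertical faces is part of their being pullbacks.
  record IsStablePushout {A B C D} (g : Hom A B) (m : Hom A C)
                         (n : Hom B D) (f : Hom C D) : Set (o ⊔ ℓ ⊔ e) where
    field
      isPushout : IsPushout g m n f
      stable    : ∀ {A′ B′ C′ D′}
                  {g′ : Hom A′ B′} {m′ : Hom A′ C′} {n′ : Hom B′ D′} {f′ : Hom C′ D′}
                  {a : Hom A′ A} {b : Hom B′ B} {c : Hom C′ C} {d : Hom D′ D} →
                  n′ ∘ g′ ≈ f′ ∘ m′ →
                  IsPullback g′ a b g → IsPullback m′ a c m →
                  IsPullback n′ b d n → IsPullback f′ c d f →
                  IsPushout g′ m′ n′ f′

  IsPreadhesive : ∀ {p} → ArrowClass p → ∀ {X Y} → Hom X Y → Set (o ⊔ ℓ ⊔ e ⊔ p)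
  IsPreadhesive 𝓝 {X} {Y} m = ∀ {Z} (n : Hom X Z) → 𝓝 n →
    ∃[ W ] Σ[ k ∈ Hom Z W ] Σ[ h ∈ Hom Y W ]
      IsStablePushout n m k h × IsPullback n m k h

  IsAdhesive : ∀ {p} → ArrowClass p → ∀ {X Y} → Hom X Y → Set (o ⊔ ℓ ⊔ e ⊔ p)
  IsAdhesive 𝓝 {X} {Y} m =
    ∀ {X′ Y′} {f : Hom X′ X} {m′ : Hom X′ Y′} {g : Hom Y′ Y} →
    IsPullback f m′ m g → IsPreadhesive 𝓝 m′

  record Subobject (X : Obj) : Set (o ⊔ ℓ ⊔ e) where
    constructor [_,_]
    field
      {dom} : Obj
      arr   : Hom dom X
      mono  : Mono arr

  module _ {X : Obj} where
    open Subobject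

    infix 4 _≤ₛ_ _≅ₛ_

    _≤ₛ_ : Rel (Subobject X) (ℓ ⊔ e)
    S ≤ₛ T = Σ[ t ∈ Hom (dom S) (dom T) ] arr T ∘ t ≈ arr S

    _≅ₛ_ : Rel (Subobject X) (ℓ ⊔ e)
    S ≅ₛ T = Σ[ i ∈ Hom (dom S) (dom T) ] IsIso i × arr T ∘ i ≈ arr S

    ≤ₛ-trans : ∀ {R S T} → R ≤ₛ S → S ≤ₛ T → R ≤ₛ T
    ≤ₛ-trans {T = T} (s , p) (t , q) =
      t ∘ s , ≈.trans (≈.sym (assoc (arr T) t s)) (≈.trans (∘-resp q ≈.refl) p)

    ≅ₛ⇒≤ₛ : ∀ {S T} → S ≅ₛ T → S ≤ₛ T
    ≅ₛ⇒≤ₛ (i , _ , p) = i , p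

    ≅ₛ⇒≥ₛ : ∀ {S T} → S ≅ₛ T → T ≤ₛ S
    ≅ₛ⇒≥ₛ {S} {T} (i , iso , p) = inv ,
      ≈.trans (∘-resp (≈.sym p) ≈.refl)
        (≈.trans (assoc (arr T) i inv)
          (≈.trans (∘-resp ≈.refl invʳ) (idʳ (arr T))))
      where open IsIso iso

    ≤ₛ-refl : ∀ {S} → S ≤ₛ S
    ≤ₛ-refl {S} = id , idʳ (arr S)

    ≤ₛ-endo : ∀ {S} ((t , _) : S ≤ₛ S) → t ≈ id
    ≤ₛ-endo {S} (t , p) = mono S t id (≈.trans p (≈.sym (idʳ (arr S))))

    ≤ₛ-antisym : ∀ {S T} → S ≤ₛ T → T ≤ₛ S → S ≅ₛ T
    ≤ₛ-antisym {S} {T} s≤t@(s , p) t≤s@(t , q) = s , record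
      { inv  = t
      ; invˡ = ≤ₛ-endo {S} (≤ₛ-trans {S} {T} {S} s≤t t≤s)
      ; invʳ = ≤ₛ-endo {T} (≤ₛ-trans {T} {S} {T} t≤s s≤t)
      } , p

  -- Isomorphism classes of monos are represented by monos, with isomorphism
  -- over X as the equality of the poset.
  Sub : Obj → Poset (o ⊔ ℓ ⊔ e) (ℓ ⊔ e) (ℓ ⊔ e)
  Sub X = record
    { Carrier = Subobject X
    ; _≈_     = _≅ₛ_
    ; _≤_     = _≤ₛ_
    ; isPartialOrder = record
      { isPreorder = record
        { isEquivalence = record
          { refl  = λ {S} → ≤ₛ-antisym {X} {S} {S} (≤ₛ-refl {X} {S}) (≤ₛ-refl {X} {S})
          ; sym   = λ {S} {T} e → ≤ₛ-antisym {X} {T} {S}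
                      (≅ₛ⇒≥ₛ {X} {S} {T} e) (≅ₛ⇒≤ₛ {X} {S} {T} e)
          ; trans = λ {R} {S} {T} d e → ≤ₛ-antisym {X} {R} {T}
                      (≤ₛ-trans {X} {R} {S} {T} (≅ₛ⇒≤ₛ {X} {R} {S} d) (≅ₛ⇒≤ₛ {X} {S} {T} e))
                      (≤ₛ-trans {X} {T} {S} {R} (≅ₛ⇒≥ₛ {X} {S} {T} e) (≅ₛ⇒≥ₛ {X} {R} {S} d))
          }
        ; reflexive = λ {S} {T} → ≅ₛ⇒≤ₛ {X} {S} {T}
        ; trans     = λ {R} {S} {T} → ≤ₛ-trans {X} {R} {S} {T}
        }
      ; antisym = λ {S} {T} → ≤ₛ-antisym {X} {S} {T}
      }
    }

-- "z = x ∨ y" in a poset that need not have all binary joins.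
record IsJoin {c ℓ₁ ℓ₂} (P : Poset c ℓ₁ ℓ₂) (z x y : Poset.Carrier P) :
              Set (c ⊔ ℓ₂) where
  open Poset P
  field
    upperˡ : x ≤ z
    upperʳ : y ≤ z
    least  : ∀ w → x ≤ w → y ≤ w → z ≤ w

{-# OPTIONS --safe #-}

-- A stable pushout square stays a pushout, hence a jointly epic cover, after
-- pulling back along any arrow into its corner U.  To see that u is monic, take
-- r, s into U with u ∘ r ≈ u ∘ s and cover their domain first by pulling back
-- along r, then along s.  On each of the four resulting pieces r and s factor
-- through M or N: if through the same one, they agree because m and n are monic;
-- if through different ones, the factorizations come from P.
module Submission where

open import Level using (Level)
open import Data.Product using (Σ-syntax; _,_)
open import Relation.Binary.Bundles using (Setoid)
import Relation.Binary.Reasoning.Setoid as SetoidReasoning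
open import Defs

module _ {o ℓ e : Level} (𝐗 : Category o ℓ e) where
  open Category 𝐗

  homSetoid : Obj → Obj → Setoid ℓ e
  homSetoid A B = record { Carrier = Hom A B ; _≈_ = _≈_ ; isEquivalence = ≈-equiv }

  module HomReasoning {A B} = SetoidReasoning (homSetoid A B)
  open HomReasoning

  ∘-respˡ : ∀ {A B C} {g g′ : Hom B C} {f : Hom A B} → g ≈ g′ → g ∘ f ≈ g′ ∘ f
  ∘-respˡ p = ∘-resp p ≈.refl

  ∘-respʳ : ∀ {A B C} {g : Hom B C} {f f′ : Hom A B} → f ≈ f′ → g ∘ f ≈ g ∘ f′
  ∘-respʳ p = ∘-resp ≈.refl p

  pullˡ : ∀ {A B C D} {h : Hom C D} {g : Hom B C} {f : Hom A B} {k : Hom B D} →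
          h ∘ g ≈ k → h ∘ (g ∘ f) ≈ k ∘ f
  pullˡ {h = h} {g} {f} p = ≈.trans (≈.sym (assoc h g f)) (∘-respˡ p)

  pullʳ : ∀ {A B C D} {h : Hom C D} {g : Hom B C} {f : Hom A B} {k : Hom A C} →
          g ∘ f ≈ k → (h ∘ g) ∘ f ≈ h ∘ k
  pullʳ {h = h} {g} {f} p = ≈.trans (assoc h g f) (∘-respʳ p)

  extendʳ : ∀ {A B C D E} {n : Hom B D} {g : Hom C D} {f : Hom A B} {m : Hom A C}
            {t : Hom E A} → n ∘ f ≈ g ∘ m → n ∘ (f ∘ t) ≈ g ∘ (m ∘ t)
  extendʳ {g = g} {m = m} {t} p = ≈.trans (pullˡ p) (assoc g m t)

  -- The arrow `j` is split monic with retraction `i`, so `u` is, up to `≈`, a composite of two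
  -- monos.
  retract-mono : ∀ {A B C} {u : Hom B C} {w : Hom A C} {j : Hom B A} {i : Hom A B} →
                 Mono 𝐗 w → w ∘ j ≈ u → i ∘ j ≈ id → Mono 𝐗 u
  retract-mono {j = j} {i} w-mono wj≈u ij≈id r s ur≈us = begin
    r            ≈⟨ idˡ r ⟨
    id ∘ r       ≈⟨ pullˡ ij≈id ⟨
    i ∘ (j ∘ r)  ≈⟨ ∘-respʳ (w-mono _ _ (≈.trans (pullˡ wj≈u) (≈.trans ur≈us (≈.sym (pullˡ wj≈u))))) ⟩
    i ∘ (j ∘ s)  ≈⟨ pullˡ ij≈id ⟩
    id ∘ s       ≈⟨ idˡ s ⟩
    s            ∎

  module _ {A B C D} {f : Hom A B} {m : Hom A C} {n : Hom B D} {g : Hom C D} where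

    pullback-swap : IsPullback 𝐗 f m n g → IsPullback 𝐗 m f g n
    pullback-swap pb = record
      { commutes  = ≈.sym commutes
      ; universal = λ h k gh≈nk →
          let t , (ft≈k , mt≈h) , unique = universal k h (≈.sym gh≈nk)
          in t , (mt≈h , ft≈k) , λ (mt≈h , ft≈k) → unique (ft≈k , mt≈h)
      }
      where open IsPullback pb

    pullback-jointlyMonic : IsPullback 𝐗 f m n g → ∀ {Q} {t t′ : Hom Q A} →
                            f ∘ t ≈ f ∘ t′ → m ∘ t ≈ m ∘ t′ → t ≈ t′
    pullback-jointlyMonic pb {t = t} {t′} ft≈ft′ mt≈mt′ =
      let _ , _ , unique = universal (f ∘ t′) (m ∘ t′) (extendʳ commutes)
      in ≈.trans (≈.sym (unique (ft≈ft′ , mt≈mt′))) (unique (≈.refl , ≈.refl))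
      where open IsPullback pb

    pushout-jointlyEpic : IsPushout 𝐗 f m n g → ∀ {Q} {t t′ : Hom D Q} →
                          t ∘ n ≈ t′ ∘ n → t ∘ g ≈ t′ ∘ g → t ≈ t′
    pushout-jointlyEpic po {t = t} {t′} tn≈t′n tg≈t′g =
      let _ , _ , unique = universal (t′ ∘ n) (t′ ∘ g)
            (≈.trans (pullʳ commutes) (≈.sym (assoc t′ g m)))
      in ≈.trans (≈.sym (unique (tn≈t′n , tg≈t′g))) (unique (≈.refl , ≈.refl))
      where open IsPushout po

  module _ {A B C D A′ B′ C′ D′ : Obj}
           {g : Hom A B} {m : Hom A C} {n : Hom B D} {f : Hom C D}
           {g′ : Hom A′ B′} {m′ : Hom A′ C′} {n′ : Hom B′ D′} {f′ : Hom C′ D′}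
           {a : Hom A′ A} {b : Hom B′ B} {c : Hom C′ C} {d : Hom D′ D} where

    -- Three vertical faces of a cube can be chosen as pullbacks, but stability asks for four; this
    -- supplies the last. By pasting, back and left form a pullback of `d` along `n ∘ g ≈ f ∘ m`,
    -- and cancelling the right face leaves the front one.
    cube-pullback : n ∘ g ≈ f ∘ m → n′ ∘ g′ ≈ f′ ∘ m′ → c ∘ m′ ≈ m ∘ a →
                    IsPullback 𝐗 g′ a b g → IsPullback 𝐗 n′ b d n →
                    IsPullback 𝐗 f′ c d f → IsPullback 𝐗 m′ a c m
    cube-pullback bottom top front back left right = record
      { commutes  = front
      -- The cone is carried to `D′` by `f′` and lifted twice, to `B′` through the left face and
      -- then to `A′` through the back one. That `m′ ∘ s` is `h` is tested on the jointly monic pair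
      -- `f′`, `c`.
      ; universal = λ h k ch≈mk →
          let t , (n′t≈f′h , bt≈gk) , _ = Left.universal (f′ ∘ h) (g ∘ k) (begin
                d ∘ (f′ ∘ h)  ≈⟨ extendʳ Right.commutes ⟩
                f ∘ (c ∘ h)   ≈⟨ ∘-respʳ ch≈mk ⟩
                f ∘ (m ∘ k)   ≈⟨ extendʳ bottom ⟨
                n ∘ (g ∘ k)   ∎)
              s , (g′s≈t , as≈k) , _ = Back.universal t k bt≈gk
              f′m′s≈f′h = begin
                f′ ∘ (m′ ∘ s)  ≈⟨ extendʳ top ⟨
                n′ ∘ (g′ ∘ s)  ≈⟨ ∘-respʳ g′s≈t ⟩
                n′ ∘ t         ≈⟨ n′t≈f′h ⟩
                f′ ∘ h         ∎
              cm′s≈ch = begin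
                c ∘ (m′ ∘ s)  ≈⟨ extendʳ front ⟩
                m ∘ (a ∘ s)   ≈⟨ ∘-respʳ as≈k ⟩
                m ∘ k         ≈⟨ ch≈mk ⟨
                c ∘ h         ∎
              m′s≈h = pullback-jointlyMonic right f′m′s≈f′h cm′s≈ch
          in s , (m′s≈h , as≈k) , λ (m′s′≈h , as′≈k) →
               let m′s≈m′s′ = ≈.trans m′s≈h (≈.sym m′s′≈h)
                   as≈as′   = ≈.trans as≈k (≈.sym as′≈k)
               in pullback-jointlyMonic back
                    (pullback-jointlyMonic left
                      (≈.trans (extendʳ top) (≈.trans (∘-respʳ m′s≈m′s′) (≈.sym (extendʳ top))))
                      (≈.trans (extendʳ Back.commutes)
                        (≈.trans (∘-respʳ as≈as′) (≈.sym (extendʳ Back.commutes)))))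
                    as≈as′
      }
      where
        module Back  = IsPullback back
        module Left  = IsPullback left
        module Right = IsPullback right

  module _ (pullbacks : HasPullbacks 𝐗) {A B C D : Obj}
           {g : Hom A B} {m : Hom A C} {n : Hom B D} {f : Hom C D}
           (stablePushout : IsStablePushout 𝐗 g m n f) where
    open IsStablePushout stablePushout
    private module Bottom = IsPushout isPushout

    -- Pulling the pushout back along `d` gives a pushout with corner `Z`, whose two legs are
    -- jointly epic. The hypotheses range over all pieces on which `d` factors, so that applying the
    -- lemma involves no chosen pullbacks.
    stablePushout-local :
      ∀ {Z Q} (d : Hom Z D) {r s : Hom Z Q} →
      (∀ {V} (v : Hom V Z) (b : Hom V B) → d ∘ v ≈ n ∘ b → r ∘ v ≈ s ∘ v) →
      (∀ {V} (v : Hom V Z) (c : Hom V C) → d ∘ v ≈ f ∘ c → r ∘ v ≈ s ∘ v) →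
      r ≈ s
    stablePushout-local d onB onC =
      let _ , n′ , b , left  = pullbacks d n
          _ , f′ , c , right = pullbacks d f
          _ , g′ , a , back  = pullbacks b g
          module Left  = IsPullback left
          module Right = IsPullback right
          module Back  = IsPullback back
          -- The missing edge of the top face is induced by the right pullback; its two equations
          -- are the commutativity of the top and front faces.
          m′ , (f′m′≈n′g′ , cm′≈ma) , _ = Right.universal (n′ ∘ g′) (m ∘ a) (begin
            d ∘ (n′ ∘ g′)  ≈⟨ extendʳ Left.commutes ⟩
            n ∘ (b ∘ g′)   ≈⟨ ∘-respʳ Back.commutes ⟩
            n ∘ (g ∘ a)    ≈⟨ extendʳ Bottom.commutes ⟩
            f ∘ (m ∘ a)    ∎)
          top   = ≈.sym f′m′≈n′g′
          front = cube-pullback Bottom.commutes top cm′≈ma back left right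
      in pushout-jointlyEpic (stable top back front left right)
           (onB n′ b Left.commutes) (onC f′ c Right.commutes)

    stablePushout-mono :
      ∀ {X} {x : Hom B X} {y : Hom C X} {w : Hom D X} →
      Mono 𝐗 x → Mono 𝐗 y → IsPullback 𝐗 g m x y → w ∘ n ≈ x → w ∘ f ≈ y → Mono 𝐗 w
    stablePushout-mono {x = x} {y} {w} x-mono y-mono pb wn≈x wf≈y r s wr≈ws =
      stablePushout-local r
        -- The second cover refines the piece `v`, hence is taken along `s ∘ v`; the factorization
        -- of `r ∘ v` is carried down to it by `restrict`.
        (λ v b rv≈nb → stablePushout-local (s ∘ v)
          (λ v′ b′ svv′≈nb′ → agree x-mono wn≈x (equalized v v′) (restrict rv≈nb) svv′≈nb′)
          (λ v′ c svv′≈fc → agree-across (equalized v v′) (restrict rv≈nb) svv′≈fc))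
        (λ v c rv≈fc → stablePushout-local (s ∘ v)
          -- Now `s` passes through `B` and `r` through `C`, so `agree-across` applies with their
          -- roles exchanged.
          (λ v′ b svv′≈nb → ≈.sym
            (agree-across (≈.sym (equalized v v′)) svv′≈nb (restrict rv≈fc)))
          (λ v′ c′ svv′≈fc′ → agree y-mono wf≈y (equalized v v′) (restrict rv≈fc) svv′≈fc′))
      where
        equalized : ∀ {V V′} (v : Hom V _) (v′ : Hom V′ V) →
                    w ∘ ((r ∘ v) ∘ v′) ≈ w ∘ ((s ∘ v) ∘ v′)
        equalized v v′ = begin
          w ∘ ((r ∘ v) ∘ v′)  ≈⟨ pullˡ (extendʳ wr≈ws) ⟩
          (w ∘ (s ∘ v)) ∘ v′  ≈⟨ assoc w (s ∘ v) v′ ⟩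
          w ∘ ((s ∘ v) ∘ v′)  ∎

        restrict : ∀ {E V V′} {ρ : Hom V D} {k : Hom E D} {b : Hom V E} {t : Hom V′ V} →
                   ρ ≈ k ∘ b → ρ ∘ t ≈ k ∘ (b ∘ t)
        restrict {k = k} {b} {t} p = ≈.trans (∘-respˡ p) (assoc k b t)

        factor : ∀ {E V} {k : Hom E D} {z : Hom E _} {ρ : Hom V D} {b : Hom V E} →
                 w ∘ k ≈ z → ρ ≈ k ∘ b → w ∘ ρ ≈ z ∘ b
        factor wk≈z ρ≈kb = ≈.trans (∘-respʳ ρ≈kb) (pullˡ wk≈z)

        agree : ∀ {E V} {k : Hom E D} {z : Hom E _} {ρ σ : Hom V D} {b b′ : Hom V E} →
                Mono 𝐗 z → w ∘ k ≈ z → w ∘ ρ ≈ w ∘ σ → ρ ≈ k ∘ b → σ ≈ k ∘ b′ → ρ ≈ σ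
        agree z-mono wk≈z wρ≈wσ ρ≈kb σ≈kb′ =
          ≈.trans ρ≈kb (≈.trans (∘-respʳ (z-mono _ _ zb≈zb′)) (≈.sym σ≈kb′))
          where
            zb≈zb′ = ≈.trans (≈.sym (factor wk≈z ρ≈kb)) (≈.trans wρ≈wσ (factor wk≈z σ≈kb′))

        -- Equality after `w` reads `x ∘ b ≈ y ∘ c`, so `b` and `c` come from a common arrow `t`
        -- into the pullback `A`, on which the two legs of the pushout square agree.
        agree-across : ∀ {V} {ρ σ : Hom V D} {b : Hom V B} {c : Hom V C} →
                       w ∘ ρ ≈ w ∘ σ → ρ ≈ n ∘ b → σ ≈ f ∘ c → ρ ≈ σ
        agree-across {ρ = ρ} {σ} {b} {c} wρ≈wσ ρ≈nb σ≈fc =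
          let t , (gt≈b , mt≈c) , _ = IsPullback.universal pb b c
                (≈.trans (≈.sym (factor wn≈x ρ≈nb)) (≈.trans wρ≈wσ (factor wf≈y σ≈fc)))
          in begin
            ρ            ≈⟨ ρ≈nb ⟩
            n ∘ b        ≈⟨ ∘-respʳ gt≈b ⟨
            n ∘ (g ∘ t)  ≈⟨ extendʳ Bottom.commutes ⟩
            f ∘ (m ∘ t)  ≈⟨ ∘-respʳ mt≈c ⟩
            f ∘ c        ≈⟨ σ≈fc ⟨
            σ            ∎

proposition3p9 : ∀ {o ℓ e p : Level} (𝐗 : Category o ℓ e) → let open Category 𝐗 in
    HasPullbacks 𝐗 →
    (𝓝 : ArrowClass 𝐗 p) → IsMatchingClass 𝐗 𝓝 →
    ∀ {M N X P U : Obj}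
    (m : Hom M X) (m-mono : Mono 𝐗 m) → IsAdhesive 𝐗 𝓝 m →
    (n : Hom N X) (n-mono : Mono 𝐗 n) → 𝓝 n →
    (p₁ : Hom P M) (p₂ : Hom P N) → IsPullback 𝐗 p₁ p₂ m n →
    (u₁ : Hom N U) (u₂ : Hom M U) → IsPushout 𝐗 p₂ p₁ u₁ u₂ →
    (u : Hom U X) → u ∘ u₁ ≈ n → u ∘ u₂ ≈ m →
    Σ[ u-mono ∈ Mono 𝐗 u ]
    IsJoin (Sub 𝐗 X) [ u , u-mono ] [ m , m-mono ] [ n , n-mono ]
proposition3p9 𝐗 pullbacks 𝓝 matching m m-mono adhesive n n-mono n∈𝓝 p₁ p₂ pb u₁ u₂ po u uu₁≈n uu₂≈m =
  u-mono , record
    { upperˡ = u₂ , uu₂≈m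
    ; upperʳ = u₁ , uu₁≈n
    ; least  = least
    }
  where
    open Category 𝐗
    open HomReasoning 𝐗
    module PB = IsPullback pb
    module PO = IsPushout po

    -- U need not be the chosen stable pushout W, so its monicity is transported
    -- along the comparison j : U → W.
    u-mono : Mono 𝐗 u
    u-mono =
      -- The square `pb` is read both ways: swapped, it makes `p₁` a pullback of `n`, hence a member
      -- of `𝓝`; as it stands, it makes `p₂` a pullback of `m`, hence preadhesive. The square
      -- obtained lists `p₁` first, so `k` starts at `M` and `h` at `N`, the reverse of `po`.
      let p₁∈𝓝 = IsMatchingClass.pullback-stable matching (pullback-swap 𝐗 pb) n∈𝓝
          _ , k , h , stablePushout , _ = adhesive pb p₁ p₁∈𝓝
          module W = IsPushout (IsStablePushout.isPushout stablePushout)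
          w , (wk≈m , wh≈n) , _     = W.universal m n PB.commutes
          i , (ik≈u₂ , ih≈u₁) , _   = W.universal u₂ u₁ (≈.sym PO.commutes)
          j , (ju₁≈h , ju₂≈k) , _   = PO.universal h k (≈.sym W.commutes)
          -- Taking `w` for `z` yields `w ∘ j ≈ u`, and taking `i` yields `i ∘ j ≈ id`: both are
          -- checked on the jointly epic pair `u₁`, `u₂`.
          through : ∀ {Q} {z : Hom _ Q} {v₁ : Hom _ Q} {v₂ : Hom _ Q} →
                    z ∘ h ≈ v₁ → z ∘ k ≈ v₂ →
                    ∀ {t : Hom _ Q} → t ∘ u₁ ≈ v₁ → t ∘ u₂ ≈ v₂ → z ∘ j ≈ t
          through zh≈v₁ zk≈v₂ tu₁≈v₁ tu₂≈v₂ = pushout-jointlyEpic 𝐗 po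
            (≈.trans (pullʳ 𝐗 ju₁≈h) (≈.trans zh≈v₁ (≈.sym tu₁≈v₁)))
            (≈.trans (pullʳ 𝐗 ju₂≈k) (≈.trans zk≈v₂ (≈.sym tu₂≈v₂)))
      in retract-mono 𝐗
           (stablePushout-mono 𝐗 pullbacks stablePushout m-mono n-mono pb wk≈m wh≈n)
           (through wh≈n wk≈m uu₁≈n uu₂≈m)
           (through ih≈u₁ ik≈u₂ (idˡ u₁) (idˡ u₂))

    least : ∀ S → _≤ₛ_ 𝐗 [ m , m-mono ] S → _≤ₛ_ 𝐗 [ n , n-mono ] S → _≤ₛ_ 𝐗 [ u , u-mono ] S
    least [ q , q-mono ] (a , qa≈m) (b , qb≈n) =
      -- Since `q` is monic, the factorizations `a` and `b` agree on `P`, and the pushout glues them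
      -- into an arrow out of `U`.
      let t , (tu₁≈b , tu₂≈a) , _ = PO.universal b a (q-mono _ _ (begin
            q ∘ (b ∘ p₂)  ≈⟨ pullˡ 𝐗 qb≈n ⟩
            n ∘ p₂        ≈⟨ PB.commutes ⟨
            m ∘ p₁        ≈⟨ pullˡ 𝐗 qa≈m ⟨
            q ∘ (a ∘ p₁)  ∎))
      in t , pushout-jointlyEpic 𝐗 po
               (≈.trans (pullʳ 𝐗 tu₁≈b) (≈.trans qb≈n (≈.sym uu₁≈n)))
               (≈.trans (pullʳ 𝐗 tu₂≈a) (≈.trans qa≈m (≈.sym uu₂≈m)))
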